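{- Let $D$ be a domain. Every searchable set $K\subseteq D$ is exhaustible.
   Context: Domains are the objects of a fixed cartesian closed category of effectively given domains (for instance effectively given Scott domains, i.e. algebraic, bounded complete, directed complete posets), containing the flat domain $\mathcal{B}=\{0,1,\bot\}$ of booleans. $(D\to E)$ denotes the domain of Scott continuous maps ordered pointwise. "Computable" is meant in the standard sense for effectively given domains; computable maps are continuous. A predicate $p\in(D\to\mathcal{B})$ is defined on $K\subseteq D$ if $p(x)\neq\bot$ for all $x\in K$. $K$ is exhaustible if there is a computable $\forall_K:(D\to\mathcal{B})\to\mathcal{B}$ such that for every $p$ defined on $K$, $\forall_K(p)=1$ if $p(x)=1$ for all $x\in K$, and $\forall_K(p)=0$ if $p(x)=0$ for some $x\in K$. $K$ is searchable if there is a computable $\varepsilon_K:(D\to\mathcal{B})\to D$ such that for every $p$ defined on $K$: $\varepsilon_K(p)\in K$, and $p(\varepsilon_K(p))=1$ if $p(x)=1$ for some $x\in K$. -}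

module Defs where

open import Axiom.ExcludedMiddle using (ExcludedMiddle)
open import Data.Empty using (⊥-elim)
open import Data.Fin using (Fin; zero; suc)
open import Data.Nat using (ℕ; zero; suc)
open import Data.Product using (Σ; Σ-syntax; ∃; ∃-syntax; _×_; _,_; proj₁; proj₂)
open import Data.Unit.Base using (tt) renaming (⊤ to Unit)
open import Data.Unit.Polymorphic.Base using (⊤)
open import Data.Vec using (Vec; []; _∷_; lookup)
open import Function using (_∘_; _⇔_; mk⇔; module Equivalence)
open import Level using (Level; 0ℓ; _⊔_) renaming (suc to lsuc)
open import Relation.Binary.Bundles using (Poset)
open import Relation.Binary.PropositionalEquality as ≡ using (_≡_; _≢_; refl; isEquivalence)
open import Relation.Nullary using (¬_; yes; no)
open import Relation.Unary using (Pred)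

1ℓ : Level
1ℓ = lsuc 0ℓ

data PrimRec : ℕ → Set where
  zeroᵖ : ∀ {n} → PrimRec n
  sucᵖ  : PrimRec 1
  projᵖ : ∀ {n} → Fin n → PrimRec n
  compᵖ : ∀ {m n} → PrimRec m → Vec (PrimRec n) m → PrimRec n
  recᵖ  : ∀ {n} → PrimRec n → PrimRec (suc (suc n)) → PrimRec (suc n)

mutual
  eval : ∀ {n} → PrimRec n → Vec ℕ n → ℕ
  eval zeroᵖ        xs           = zero
  eval sucᵖ         (x ∷ [])     = suc x
  eval (projᵖ i)    xs           = lookup xs i
  eval (compᵖ f gs) xs           = eval f (evals gs xs)
  eval (recᵖ f g)   (zero ∷ xs)  = eval f xs
  eval (recᵖ f g)   (suc x ∷ xs) = eval g (x ∷ eval (recᵖ f g) (x ∷ xs) ∷ xs)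

  evals : ∀ {m n} → Vec (PrimRec n) m → Vec ℕ n → Vec ℕ m
  evals []       xs = []
  evals (g ∷ gs) xs = eval g xs ∷ evals gs xs

-- Kleene's form of recursive enumerability (Σ⁰₁): R is a projection of a
-- primitive recursive relation.
RE : ∀ {r} → (ℕ → ℕ → Set r) → Set r
RE R = Σ[ f ∈ PrimRec 3 ] (∀ m n → R m n ⇔ (∃[ k ] eval f (m ∷ n ∷ k ∷ []) ≡ 0))

-- Carriers, equalities and orders live in Set₁ while directed families are
-- indexed by types in Set; this makes the class of dcpos closed under function
-- spaces without raising universe levels.

Poset₁ : Set₂
Poset₁ = Poset 1ℓ 1ℓ 1ℓ

module _ (P : Poset₁) where
  open Poset P using (Carrier; _≤_)

  Directed : {I : Set} → (I → Carrier) → Set₁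
  Directed {I} s = I × (∀ i j → ∃[ k ] (s i ≤ s k × s j ≤ s k))

  record IsLub {I : Set} (s : I → Carrier) (x : Carrier) : Set₁ where
    field
      upper : ∀ i → s i ≤ x
      least : ∀ y → (∀ i → s i ≤ y) → x ≤ y

record DCPO : Set₂ where
  field
    poset : Poset₁
  open Poset poset public
    renaming (refl to ≤-refl; trans to ≤-trans; reflexive to ≤-reflexive)
  field
    ⋁     : {I : Set} (s : I → Carrier) → Directed poset s → Carrier
    ⋁-lub : {I : Set} (s : I → Carrier) (d : Directed poset s) → IsLub poset s (⋁ s d)

∣_∣ : DCPO → Set₁
∣ D ∣ = DCPO.Carrier D

infix 4 _⟶_

record _⟶_ (D E : DCPO) : Set₁ where
  private
    module D = DCPO D
    module E = DCPO E
  field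
    app        : ∣ D ∣ → ∣ E ∣
    monotone   : ∀ {x y} → x D.≤ y → app x E.≤ app y
    continuous : {I : Set} (s : I → ∣ D ∣) → Directed D.poset s →
                 ∀ x → IsLub D.poset s x → IsLub E.poset (app ∘ s) (app x)

open _⟶_ public using (app)

mono-directed : ∀ {D E} (f : D ⟶ E) {I : Set} (s : I → ∣ D ∣) →
                Directed (DCPO.poset D) s → Directed (DCPO.poset E) (app f ∘ s)
mono-directed f s (i₀ , up) =
  i₀ , λ i j → let (k , p , q) = up i j in k , _⟶_.monotone f p , _⟶_.monotone f q

𝟙ᵈ : DCPO
𝟙ᵈ = record
  { poset = record
    { Carrier = ⊤
    ; _≈_ = _≡_
    ; _≤_ = λ _ _ → ⊤
    ; isPartialOrder = record
      { isPreorder = record { isEquivalence = isEquivalence }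
      ; antisym = λ _ _ → refl
      }
    }
  ; ⋁ = λ _ _ → _
  ; ⋁-lub = λ _ _ → record {}
  }

infixr 5 _×ᵈ_

_×ᵈ_ : DCPO → DCPO → DCPO
D ×ᵈ E = record
  { poset = record
    { Carrier = ∣ D ∣ × ∣ E ∣
    ; _≈_ = λ (x , y) (x′ , y′) → (x D.≈ x′) × (y E.≈ y′)
    ; _≤_ = _≤×_
    ; isPartialOrder = record
      { isPreorder = record
        { isEquivalence = record
          { refl  = D.Eq.refl , E.Eq.refl
          ; sym   = λ (p , q) → D.Eq.sym p , E.Eq.sym q
          ; trans = λ (p , q) (p′ , q′) → D.Eq.trans p p′ , E.Eq.trans q q′
          }
        ; reflexive = λ (p , q) → D.≤-reflexive p , E.≤-reflexive q
        ; trans = λ (p , q) (p′ , q′) → D.≤-trans p p′ , E.≤-trans q q′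
        }
      ; antisym = λ (p , q) (p′ , q′) → D.antisym p p′ , E.antisym q q′
      }
    }
  ; ⋁ = λ s d → D.⋁ (proj₁ ∘ s) (dir₁ d) , E.⋁ (proj₂ ∘ s) (dir₂ d)
  ; ⋁-lub = λ s d →
      let module L = IsLub (D.⋁-lub (proj₁ ∘ s) (dir₁ d))
          module M = IsLub (E.⋁-lub (proj₂ ∘ s) (dir₂ d))
      in record
        { upper = λ i → L.upper i , M.upper i
        ; least = λ (x , y) u → L.least x (proj₁ ∘ u) , M.least y (proj₂ ∘ u)
        }
  }
  where
  module D = DCPO D
  module E = DCPO E
  _≤×_ : ∣ D ∣ × ∣ E ∣ → ∣ D ∣ × ∣ E ∣ → Set₁
  (x , y) ≤× (x′ , y′) = (x D.≤ x′) × (y E.≤ y′)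
  Directed× : {I : Set} → (I → ∣ D ∣ × ∣ E ∣) → Set₁
  Directed× {I} s = I × (∀ i j → ∃[ k ] ((s i ≤× s k) × (s j ≤× s k)))
  dir₁ : {I : Set} {s : I → ∣ D ∣ × ∣ E ∣} → Directed× s → Directed D.poset (proj₁ ∘ s)
  dir₁ (i₀ , up) = i₀ , λ i j → let (k , p , q) = up i j in k , proj₁ p , proj₁ q
  dir₂ : {I : Set} {s : I → ∣ D ∣ × ∣ E ∣} → Directed× s → Directed E.poset (proj₂ ∘ s)
  dir₂ (i₀ , up) = i₀ , λ i j → let (k , p , q) = up i j in k , proj₂ p , proj₂ q

module _ (D E : DCPO) where
  private
    module D = DCPO D
    module E = DCPO E

  pointwise : Poset₁
  pointwise = record
    { Carrier = D ⟶ E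
    ; _≈_ = λ f g → ∀ x → app f x E.≈ app g x
    ; _≤_ = λ f g → ∀ x → app f x E.≤ app g x
    ; isPartialOrder = record
      { isPreorder = record
        { isEquivalence = record
          { refl  = λ _ → E.Eq.refl
          ; sym   = λ p x → E.Eq.sym (p x)
          ; trans = λ p q x → E.Eq.trans (p x) (q x)
          }
        ; reflexive = λ p x → E.≤-reflexive (p x)
        ; trans = λ p q x → E.≤-trans (p x) (q x)
        }
      ; antisym = λ p q x → E.antisym (p x) (q x)
      }
    }

  directed-at : {I : Set} (s : I → D ⟶ E) → Directed pointwise s →
                ∀ x → Directed E.poset (λ i → app (s i) x)
  directed-at s (i₀ , up) x = i₀ , λ i j → let (k , p , q) = up i j in k , p x , q x

  module _ {I : Set} (s : I → D ⟶ E) (d : Directed pointwise s) where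
    private
      module L x = IsLub (E.⋁-lub (λ i → app (s i) x) (directed-at s d x))

    ⋁-pointwise : D ⟶ E
    ⋁-pointwise = record
      { app = λ x → E.⋁ (λ i → app (s i) x) (directed-at s d x)
      ; monotone = λ {x} {y} x≤y →
          L.least x _ λ i → E.≤-trans (_⟶_.monotone (s i) x≤y) (L.upper y i)
      ; continuous = λ t t-dir x x-lub → record
        { upper = λ j → L.least (t j) _ λ i →
            E.≤-trans (_⟶_.monotone (s i) (IsLub.upper x-lub j)) (L.upper x i)
        ; least = λ y u → L.least x y λ i →
            IsLub.least (_⟶_.continuous (s i) t t-dir x x-lub) y
              λ j → E.≤-trans (L.upper (t j) i) (u j)
        }
      }

    ⋁-pointwise-lub : IsLub pointwise s ⋁-pointwise
    ⋁-pointwise-lub = record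
      { upper = λ i x → L.upper x i
      ; least = λ g u x → L.least x (app g x) λ i → u i x
      }

    lub-at : ∀ f → IsLub pointwise s f → ∀ x → IsLub E.poset (λ i → app (s i) x) (app f x)
    lub-at f f-lub x = record
      { upper = λ i → IsLub.upper f-lub i x
      ; least = λ y u → E.≤-trans
          (IsLub.least f-lub ⋁-pointwise (IsLub.upper ⋁-pointwise-lub) x)
          (L.least x y u)
      }

infixr 4 _⇒ᵈ_

_⇒ᵈ_ : DCPO → DCPO → DCPO
D ⇒ᵈ E = record
  { poset = pointwise D E
  ; ⋁ = ⋁-pointwise D E
  ; ⋁-lub = ⋁-pointwise-lub D E
  }

toTerminal : (C : DCPO) → C ⟶ 𝟙ᵈ
toTerminal C = record
  { app = λ _ → _
  ; monotone = λ _ → _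
  ; continuous = λ _ _ _ _ → record {}
  }

module _ (D E : DCPO) where
  private
    module D = DCPO D
    module E = DCPO E

  fst : D ×ᵈ E ⟶ D
  fst = record
    { app = proj₁
    ; monotone = proj₁
    ; continuous = λ s d (x , y) l → record
      { upper = λ i → proj₁ (IsLub.upper l i)
      ; least = λ z u → proj₁ (IsLub.least l (z , y) λ i → u i , proj₂ (IsLub.upper l i))
      }
    }

  snd : D ×ᵈ E ⟶ E
  snd = record
    { app = proj₂
    ; monotone = proj₂
    ; continuous = λ s d (x , y) l → record
      { upper = λ i → proj₂ (IsLub.upper l i)
      ; least = λ z u → proj₂ (IsLub.least l (x , z) λ i → proj₁ (IsLub.upper l i) , u i)
      }
    }

  pair : ∀ {C} → C ⟶ D → C ⟶ E → C ⟶ D ×ᵈ E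
  pair f g = record
    { app = λ c → app f c , app g c
    ; monotone = λ c≤c′ → _⟶_.monotone f c≤c′ , _⟶_.monotone g c≤c′
    ; continuous = λ s d c l →
        let module L = IsLub (_⟶_.continuous f s d c l)
            module M = IsLub (_⟶_.continuous g s d c l)
        in record
          { upper = λ i → L.upper i , M.upper i
          ; least = λ (x , y) u → L.least x (proj₁ ∘ u) , M.least y (proj₂ ∘ u)
          }
    }

module _ (D E : DCPO) where
  private
    module D = DCPO D
    module E = DCPO E

  apply : (D ⇒ᵈ E) ×ᵈ D ⟶ E
  apply = record
    { app = λ (f , x) → app f x
    ; monotone = λ {(f , x)} {(g , y)} (f≤g , x≤y) →
        E.≤-trans (_⟶_.monotone f x≤y) (f≤g y)
    ; continuous = λ s d (f , x) l →
        let φ     = proj₁ ∘ s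
            t     = proj₂ ∘ s
            φ-dir = mono-directed (fst (D ⇒ᵈ E) D) s d
            t-dir = mono-directed (snd (D ⇒ᵈ E) D) s d
            φ-lub = _⟶_.continuous (fst (D ⇒ᵈ E) D) s d (f , x) l
            t-lub = _⟶_.continuous (snd (D ⇒ᵈ E) D) s d (f , x) l
        in record
          { upper = λ i → E.≤-trans (IsLub.upper φ-lub i (t i))
                            (_⟶_.monotone f (IsLub.upper t-lub i))
          ; least = λ y u →
              IsLub.least (lub-at D E φ φ-dir f φ-lub x) y λ i →
              IsLub.least (_⟶_.continuous (φ i) t t-dir x t-lub) y λ j →
              let (k , (φi≤φk , _) , (_ , tj≤tk)) = proj₂ d i j in
              E.≤-trans (φi≤φk (t j)) (E.≤-trans (_⟶_.monotone (φ k) tj≤tk) (u k))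
          }
    }

  curry : ∀ {C} → C ×ᵈ D ⟶ E → C ⟶ (D ⇒ᵈ E)
  curry {C} f = record
    { app = λ c → record
      { app = λ x → app f (c , x)
      ; monotone = λ x≤y → _⟶_.monotone f (C.≤-refl , x≤y)
      ; continuous = λ s (i₀ , up) x l → _⟶_.continuous f (λ i → c , s i)
          (i₀ , λ i j → let (k , p , q) = up i j in k , (C.≤-refl , p) , (C.≤-refl , q))
          (c , x)
          (record
            { upper = λ i → C.≤-refl , IsLub.upper l i
            ; least = λ (c′ , y) u → proj₁ (u i₀) , IsLub.least l y (proj₂ ∘ u)
            })
      }
    ; monotone = λ c≤c′ x → _⟶_.monotone f (c≤c′ , D.≤-refl)
    ; continuous = λ s (i₀ , up) c l →
        let at = λ x → _⟶_.continuous f (λ i → s i , x)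
              (i₀ , λ i j → let (k , p , q) = up i j in k , (p , D.≤-refl) , (q , D.≤-refl))
              (c , x)
              (record
                { upper = λ i → IsLub.upper l i , D.≤-refl
                ; least = λ (c′ , y) u → IsLub.least l c′ (proj₁ ∘ u) , proj₂ (u i₀)
                })
        in record
          { upper = λ i x → IsLub.upper (at x) i
          ; least = λ g u x → IsLub.least (at x) (app g x) λ i → u i x
          }
    }
    where module C = DCPO C

module _ (D : DCPO) where
  open DCPO D

  infix 4 _≪_

  _≪_ : ∣ D ∣ → ∣ D ∣ → Set₁
  x ≪ y = (I : Set) (s : I → ∣ D ∣) → Directed poset s →
          ∀ z → IsLub poset s z → y ≤ z → ∃[ i ] x ≤ s i

  -- The sequence β enumerates a basis of the continuous dcpo D in the usual
  -- sense: every x is the supremum of a directed set of basis elements way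
  -- below x.  For an algebraic domain one takes β to enumerate the compact
  -- elements, on which x ≪ y is equivalent to x ≤ y.
  record EffectiveStructure : Set₁ where
    field
      β     : ℕ → ∣ D ∣
      basis : ∀ x → Σ[ I ∈ Set ] Σ[ α ∈ (I → ℕ) ]
                Directed poset (β ∘ α) × (∀ i → β (α i) ≪ x) × IsLub poset (β ∘ α) x
      ≪-re  : RE (λ m n → β m ≪ β n)

record Domain : Set₂ where
  constructor _given-by_
  field
    dcpo : DCPO
    eff  : EffectiveStructure dcpo

Computable : (D E : Domain) → Domain.dcpo D ⟶ Domain.dcpo E → Set₁
Computable D E f = RE (λ m n → _≪_ (Domain.dcpo E) (e n) (app f (d m)))
  where
  d = EffectiveStructure.β (Domain.eff D)
  e = EffectiveStructure.β (Domain.eff E)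

data Bool⊥ : Set₁ where
  bot 𝟎 𝟏 : Bool⊥

infix 4 _⊑_

data _⊑_ : Bool⊥ → Bool⊥ → Set₁ where
  bot⊑   : ∀ {x} → bot ⊑ x
  ⊑-refl : ∀ {x} → x ⊑ x

flat : Poset₁
flat = record
  { Carrier = Bool⊥
  ; _≈_ = _≡_
  ; _≤_ = _⊑_
  ; isPartialOrder = record
    { isPreorder = record
      { isEquivalence = isEquivalence
      ; reflexive = λ { refl → ⊑-refl }
      ; trans = λ { bot⊑ _ → bot⊑ ; ⊑-refl q → q }
      }
    ; antisym = λ { bot⊑ bot⊑ → refl ; bot⊑ ⊑-refl → refl ; ⊑-refl _ → refl }
    }
  }

βᵇ : ℕ → Bool⊥
βᵇ 0             = bot
βᵇ 1             = 𝟎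
βᵇ (suc (suc _)) = 𝟏

-- Directed completeness of the three-element poset is not constructively
-- provable, so excluded middle is taken as a parameter from here on.
module _ (em : ExcludedMiddle 1ℓ) where

  private
    open IsLub

    hit : {I : Set} (s : I → Bool⊥) → Directed flat s → ∀ b i → b ≢ bot → s i ≡ b → IsLub flat s b
    hit s (_ , up) b i b≢⊥ refl = record
      { upper = λ j → let (k , p , q) = up i j in below (s i) (s j) (s k) b≢⊥ p q
      ; least = λ _ u → u i
      }
      where
      below : ∀ x y z → x ≢ bot → x ⊑ z → y ⊑ z → y ⊑ x
      below x y z x≢⊥ bot⊑   q = ⊥-elim (x≢⊥ refl)
      below x y z x≢⊥ ⊑-refl q = q

    lub : {I : Set} (s : I → Bool⊥) → Directed flat s → ∃ (IsLub flat s)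
    lub s d with em {∃[ i ] s i ≡ 𝟎}
    ... | yes (i , p) = 𝟎 , hit s d 𝟎 i (λ ()) p
    ... | no ¬𝟎 with em {∃[ i ] s i ≡ 𝟏}
    ...   | yes (i , p) = 𝟏 , hit s d 𝟏 i (λ ()) p
    ...   | no ¬𝟏 = bot , record
      { upper = λ i → down i (s i) refl
      ; least = λ _ _ → bot⊑
      }
      where
      down : ∀ i x → s i ≡ x → x ⊑ bot
      down i bot _ = bot⊑
      down i 𝟎   p = ⊥-elim (¬𝟎 (i , p))
      down i 𝟏   p = ⊥-elim (¬𝟏 (i , p))

  𝔹ᵈ : DCPO
  𝔹ᵈ = record
    { poset = flat
    ; ⋁ = λ s d → proj₁ (lub s d)
    ; ⋁-lub = λ s d → proj₂ (lub s d)
    }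

  private
    index : Bool⊥ → ℕ
    index bot = 0
    index 𝟎   = 1
    index 𝟏   = 2

    β-index : ∀ x → βᵇ (index x) ≡ x
    β-index bot = refl
    β-index 𝟎   = refl
    β-index 𝟏   = refl

    compact : ∀ x → _≪_ 𝔹ᵈ x x
    compact x I s (i₀ , _) z l x⊑z with em {∃[ i ] x ⊑ s i}
    ... | yes p = p
    ... | no ¬p with l .least bot (λ i → down (s i) x⊑z (l .upper i) (λ q → ¬p (i , q)))
      where
      down : ∀ y → x ⊑ z → y ⊑ z → ¬ (x ⊑ y) → y ⊑ bot
      down y bot⊑   _      ¬q = ⊥-elim (¬q bot⊑)
      down y ⊑-refl bot⊑   ¬q = bot⊑
      down y ⊑-refl ⊑-refl ¬q = ⊥-elim (¬q ⊑-refl)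
    ...   | z⊑⊥ = i₀ , bottom x⊑z z⊑⊥
      where
      bottom : ∀ {x z y} → x ⊑ z → z ⊑ bot → x ⊑ y
      bottom bot⊑   _      = bot⊑
      bottom ⊑-refl bot⊑   = bot⊑
      bottom ⊑-refl ⊑-refl = bot⊑

    ≪⇔⊑ : ∀ x y → _≪_ 𝔹ᵈ x y ⇔ x ⊑ y
    ≪⇔⊑ x y = mk⇔
      (λ x≪y → proj₂ (x≪y Unit (λ _ → y) (tt , λ _ _ → tt , ⊑-refl , ⊑-refl) y
                 (record { upper = λ _ → ⊑-refl ; least = λ _ u → u tt }) ⊑-refl))
      (λ x⊑y I s d z l y⊑z → compact x I s d z l (Poset.trans flat x⊑y y⊑z))

    oneᵖ : ∀ {n} → PrimRec n
    oneᵖ = compᵖ sucᵖ (zeroᵖ ∷ [])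

    is1ᵖ ≥2ᵖ : PrimRec 1
    is1ᵖ = recᵖ oneᵖ (recᵖ zeroᵖ oneᵖ)
    ≥2ᵖ  = recᵖ oneᵖ (recᵖ oneᵖ zeroᵖ)

    ⊑ᵖ : PrimRec 3
    ⊑ᵖ = recᵖ zeroᵖ (recᵖ (compᵖ is1ᵖ (projᵖ (suc zero) ∷ []))
                          (compᵖ ≥2ᵖ (projᵖ (suc (suc (suc zero))) ∷ [])))

    ⊑-sound : ∀ m n k → eval ⊑ᵖ (m ∷ n ∷ k ∷ []) ≡ 0 → βᵇ m ⊑ βᵇ n
    ⊑-sound 0             n             k e = bot⊑
    ⊑-sound 1             1             k e = ⊑-refl
    ⊑-sound (suc (suc m)) (suc (suc n)) k e = ⊑-refl

    ⊑-complete : ∀ m n → βᵇ m ⊑ βᵇ n → eval ⊑ᵖ (m ∷ n ∷ 0 ∷ []) ≡ 0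
    ⊑-complete 0             n             p = refl
    ⊑-complete 1             1             p = refl
    ⊑-complete (suc (suc m)) (suc (suc n)) p = refl

  𝔹-effective : EffectiveStructure 𝔹ᵈ
  𝔹-effective = record
    { β     = βᵇ
    ; basis = λ x → Unit , (λ _ → index x) ,
        (tt , λ _ _ → tt , ⊑-refl , ⊑-refl) ,
        (λ _ → ≪⇔⊑ _ _ .Equivalence.from (Poset.reflexive flat (β-index x))) ,
        record
          { upper = λ _ → Poset.reflexive flat (β-index x)
          ; least = λ y u → Poset.trans flat (Poset.reflexive flat (≡.sym (β-index x))) (u tt)
          }
    ; ≪-re  = ⊑ᵖ , λ m n → mk⇔
        (λ p → 0 , ⊑-complete m n (≪⇔⊑ _ _ .Equivalence.to p))
        (λ (k , e) → ≪⇔⊑ _ _ .Equivalence.from (⊑-sound m n k e))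
    }

  𝔹-domain : Domain
  𝔹-domain = 𝔹ᵈ given-by 𝔹-effective

  -- A class of effectively given domains, regarded as a full subcategory of
  -- the category of effectively given domains and computable maps, that
  -- contains the booleans and is cartesian closed.  The underlying dcpos of
  -- the terminal object, products and exponentials are the standard ones (so
  -- that the equations and uniqueness clauses of the universal properties hold
  -- by construction), but their effective structures are chosen by the
  -- category, subject to computability of the structure maps.
  record CCC (ℓ : Level) : Set (lsuc 1ℓ ⊔ lsuc ℓ) where
    field
      Ob : Domain → Set ℓ

    Object : Set (lsuc 1ℓ ⊔ ℓ)
    Object = Σ Domain Ob

    ⟦_⟧ : Object → DCPO
    ⟦ A ⟧ = Domain.dcpo (proj₁ A)

    IsComputable : (A B : Object) → ⟦ A ⟧ ⟶ ⟦ B ⟧ → Set₁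
    IsComputable A B = Computable (proj₁ A) (proj₁ B)

    field
      𝔹-ob  : Ob 𝔹-domain
      𝟙-eff : EffectiveStructure 𝟙ᵈ
      𝟙-ob  : Ob (𝟙ᵈ given-by 𝟙-eff)
      ×-eff : (A B : Object) → EffectiveStructure (⟦ A ⟧ ×ᵈ ⟦ B ⟧)
      ×-ob  : (A B : Object) → Ob ((⟦ A ⟧ ×ᵈ ⟦ B ⟧) given-by ×-eff A B)
      ⇒-eff : (A B : Object) → EffectiveStructure (⟦ A ⟧ ⇒ᵈ ⟦ B ⟧)
      ⇒-ob  : (A B : Object) → Ob ((⟦ A ⟧ ⇒ᵈ ⟦ B ⟧) given-by ⇒-eff A B)

    infixr 5 _⊗_
    infixr 4 _⇒_

    𝔹 : Object
    𝔹 = 𝔹-domain , 𝔹-ob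

    𝟙 : Object
    𝟙 = (𝟙ᵈ given-by 𝟙-eff) , 𝟙-ob

    _⊗_ : Object → Object → Object
    A ⊗ B = ((⟦ A ⟧ ×ᵈ ⟦ B ⟧) given-by ×-eff A B) , ×-ob A B

    _⇒_ : Object → Object → Object
    A ⇒ B = ((⟦ A ⟧ ⇒ᵈ ⟦ B ⟧) given-by ⇒-eff A B) , ⇒-ob A B

    field
      !-computable     : ∀ A → IsComputable A 𝟙 (toTerminal ⟦ A ⟧)
      fst-computable   : ∀ A B → IsComputable (A ⊗ B) A (fst ⟦ A ⟧ ⟦ B ⟧)
      snd-computable   : ∀ A B → IsComputable (A ⊗ B) B (snd ⟦ A ⟧ ⟦ B ⟧)
      pair-computable  : ∀ A B C (f : ⟦ C ⟧ ⟶ ⟦ A ⟧) (g : ⟦ C ⟧ ⟶ ⟦ B ⟧) →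
                         IsComputable C A f → IsComputable C B g →
                         IsComputable C (A ⊗ B) (pair ⟦ A ⟧ ⟦ B ⟧ f g)
      apply-computable : ∀ A B → IsComputable ((A ⇒ B) ⊗ A) B (apply ⟦ A ⟧ ⟦ B ⟧)
      curry-computable : ∀ A B C (f : ⟦ C ⟧ ×ᵈ ⟦ A ⟧ ⟶ ⟦ B ⟧) →
                         IsComputable (C ⊗ A) B f →
                         IsComputable C (A ⇒ B) (curry ⟦ A ⟧ ⟦ B ⟧ f)

  module _ {ℓ k} (𝒞 : CCC ℓ) (D : CCC.Object 𝒞) (K : Pred ∣ CCC.⟦_⟧ 𝒞 D ∣ k) where
    open CCC 𝒞

    DefinedOn : ⟦ D ⟧ ⟶ ⟦ 𝔹 ⟧ → Set (1ℓ ⊔ k)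
    DefinedOn p = ∀ x → K x → app p x ≢ bot

    Exhaustible : Set (1ℓ ⊔ k)
    Exhaustible = Σ[ ∀ᴷ ∈ (⟦ D ⇒ 𝔹 ⟧ ⟶ ⟦ 𝔹 ⟧) ]
      IsComputable (D ⇒ 𝔹) 𝔹 ∀ᴷ ×
      (∀ p → DefinedOn p →
        ((∀ x → K x → app p x ≡ 𝟏) → app ∀ᴷ p ≡ 𝟏) ×
        ((∃[ x ] (K x × app p x ≡ 𝟎)) → app ∀ᴷ p ≡ 𝟎))

    Searchable : Set (1ℓ ⊔ k)
    Searchable = Σ[ ε ∈ (⟦ D ⇒ 𝔹 ⟧ ⟶ ⟦ D ⟧) ]
      IsComputable (D ⇒ 𝔹) D ε ×
      (∀ p → DefinedOn p →
        K (app ε p) ×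
        ((∃[ x ] (K x × app p x ≡ 𝟏)) → app p (app ε p) ≡ 𝟏))

{-# OPTIONS --safe #-}

-- Put ∀(p) = p(ε(¬ ∘ p)): the candidate ε(¬ ∘ p) lies in K and is a
-- counterexample to p whenever K contains one.  This map is assembled from the
-- cartesian closed structure, so its computability amounts to that of negation
-- and to closure of computable maps under composition.  For the latter,
-- interpolation gives c ≪ g (f a) iff b ≪ f a and c ≪ g b for some basis
-- element b, and recursively enumerable relations are closed under relational
-- composition.

module Submission where

open import Defs
open import Axiom.ExcludedMiddle using (ExcludedMiddle)
open import Data.Fin using (Fin; zero; suc; _↑ʳ_)
open import Data.Fin.Patterns using (0F; 1F; 2F; 3F)
open import Data.Nat using (ℕ; zero; suc; _<_; s≤s; _⊔_)
open import Data.Nat.Properties using (n<1+n; m<n⇒m<1+n; m<1+n⇒m<n∨m≡n; m≤m⊔n; m≤n⊔m)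
  renaming (≤-trans to ≤-transᴺ)
open import Data.Product using (Σ; ∃-syntax; _×_; _,_; proj₁; proj₂)
open import Data.Sum using (_⊎_; inj₁; inj₂)
open import Data.Vec using (Vec; []; _∷_; lookup; tabulate)
open import Data.Vec.Properties using (tabulate∘lookup)
open import Function using (_∘_; _⇔_; mk⇔; module Equivalence)
open import Function.Properties.Equivalence using () renaming (trans to ⇔-trans)
open import Relation.Binary.PropositionalEquality using (_≡_; _≢_; refl; sym; trans; cong; subst)
open import Relation.Unary using (Pred)

open Equivalence using (to; from)

-- Bounded search by primitive recursion

-- Primitive recursive characteristic functions take the value 0 for "true".

orᵖ andᵖ : PrimRec 2
orᵖ  = recᵖ zeroᵖ (projᵖ 2F)
andᵖ = recᵖ (projᵖ 0F) (compᵖ sucᵖ (zeroᵖ ∷ []))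

eval-orᵖ : ∀ a b → eval orᵖ (a ∷ b ∷ []) ≡ 0 ⇔ (a ≡ 0 ⊎ b ≡ 0)
eval-orᵖ zero    b = mk⇔ inj₁ (λ _ → refl)
eval-orᵖ (suc a) b = mk⇔ inj₂ (λ { (inj₁ ()) ; (inj₂ p) → p })

eval-andᵖ : ∀ a b → eval andᵖ (a ∷ b ∷ []) ≡ 0 ⇔ (a ≡ 0 × b ≡ 0)
eval-andᵖ zero    b = mk⇔ (refl ,_) proj₂
eval-andᵖ (suc a) b = mk⇔ (λ ()) (λ ())

-- An arbitrary reindexing `ρ` is allowed because the induction passes from `ρ` to `ρ ∘ suc`.
evals-projᵖ : ∀ {m n} (ρ : Fin m → Fin n) xs →
              evals (tabulate (projᵖ ∘ ρ)) xs ≡ tabulate (lookup xs ∘ ρ)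
evals-projᵖ {zero}  ρ xs = refl
evals-projᵖ {suc m} ρ xs = cong (lookup xs (ρ zero) ∷_) (evals-projᵖ (ρ ∘ suc) xs)

-- The starting value 1 means "false", as nothing lies below the bound 0. The shift `2 ↑ʳ_` skips
-- the counter and the accumulator that `recᵖ` puts before the parameters.
∃<ᵖ : ∀ {n} → PrimRec (suc n) → PrimRec (suc n)
∃<ᵖ f = recᵖ (compᵖ sucᵖ (zeroᵖ ∷ []))
  (compᵖ orᵖ (projᵖ 1F ∷ compᵖ f (projᵖ 0F ∷ tabulate (projᵖ ∘ (2 ↑ʳ_))) ∷ []))

eval-∃<ᵖ : ∀ {n} (f : PrimRec (suc n)) N xs →
           eval (∃<ᵖ f) (N ∷ xs) ≡ 0 ⇔ (∃[ k ] (k < N × eval f (k ∷ xs) ≡ 0))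
eval-∃<ᵖ f zero    xs = mk⇔ (λ ()) (λ { (_ , () , _) })
eval-∃<ᵖ f (suc N) xs = mk⇔
  (λ e → split (eval-orᵖ _ _ .to e))
  (λ (k , k<1+N , e) → eval-orᵖ _ _ .from (join k e (m<1+n⇒m<n∨m≡n k<1+N)))
  where
  acc = eval (∃<ᵖ f) (N ∷ xs)
  new = eval f (N ∷ evals (tabulate (projᵖ ∘ (2 ↑ʳ_))) (N ∷ acc ∷ xs))

  new≡ : new ≡ eval f (N ∷ xs)
  new≡ = cong (λ ys → eval f (N ∷ ys))
    (trans (evals-projᵖ (2 ↑ʳ_) (N ∷ acc ∷ xs)) (tabulate∘lookup xs))

  split : acc ≡ 0 ⊎ new ≡ 0 → ∃[ k ] (k < suc N × eval f (k ∷ xs) ≡ 0)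
  split (inj₁ e) = let (k , k<N , e′) = eval-∃<ᵖ f N xs .to e in k , m<n⇒m<1+n k<N , e′
  split (inj₂ e) = N , n<1+n N , trans (sym new≡) e

  join : ∀ k → eval f (k ∷ xs) ≡ 0 → k < N ⊎ k ≡ N → acc ≡ 0 ⊎ new ≡ 0
  join k e (inj₁ k<N)  = inj₁ (eval-∃<ᵖ f N xs .from (k , k<N , e))
  join k e (inj₂ refl) = inj₂ (trans new≡ e)

-- Closure properties of recursively enumerable relations

RE-cong : ∀ {r s} {R : ℕ → ℕ → Set r} {S : ℕ → ℕ → Set s} →
          (∀ m n → S m n ⇔ R m n) → RE R → RE S
RE-cong S⇔R (f , R⇔f) = f , λ m n → ⇔-trans (S⇔R m n) (R⇔f m n)

RE-flip : ∀ {r} {R : ℕ → ℕ → Set r} (h : PrimRec 1) → RE R →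
          RE (λ m n → R n (eval h (m ∷ [])))
RE-flip h (f , R⇔f) =
  compᵖ f (projᵖ 1F ∷ compᵖ h (projᵖ 0F ∷ []) ∷ projᵖ 2F ∷ []) ,
  λ m n → R⇔f n (eval h (m ∷ []))

-- The three unbounded existentials are merged into one common bound N, which
-- avoids coding tuples as numbers.
RE-∘ : ∀ {r s} {R : ℕ → ℕ → Set r} {S : ℕ → ℕ → Set s} →
       RE R → RE S → RE (λ m n → ∃[ k ] (R m k × S k n))
RE-∘ {R = R} {S} (f , R⇔f) (g , S⇔g) = h , λ m n → mk⇔ (complete m n) (sound m n)
  where
  f< g< : PrimRec 3
  f< = ∃<ᵖ (compᵖ f (projᵖ 2F ∷ projᵖ 1F ∷ projᵖ 0F ∷ []))
  g< = ∃<ᵖ (compᵖ g (projᵖ 1F ∷ projᵖ 2F ∷ projᵖ 0F ∷ []))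

  both : PrimRec 4
  both = compᵖ andᵖ
    ( compᵖ f< (projᵖ 1F ∷ projᵖ 0F ∷ projᵖ 2F ∷ [])
    ∷ compᵖ g< (projᵖ 1F ∷ projᵖ 0F ∷ projᵖ 3F ∷ [])
    ∷ [])

  h : PrimRec 3
  -- `N` is passed twice: as the bound on `k`, and as a parameter bounding the witnesses for `R` and
  -- `S`.
  h = compᵖ (∃<ᵖ both) (projᵖ 2F ∷ projᵖ 2F ∷ projᵖ 0F ∷ projᵖ 1F ∷ [])

  sound : ∀ m n → ∃[ N ] eval h (m ∷ n ∷ N ∷ []) ≡ 0 → ∃[ k ] (R m k × S k n)
  sound m n (N , e) =
    let (k , _ , e′)  = eval-∃<ᵖ both N (N ∷ m ∷ n ∷ []) .to e
        (ef , eg)     = eval-andᵖ (eval f< (N ∷ k ∷ m ∷ [])) (eval g< (N ∷ k ∷ n ∷ [])) .to e′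
        (i , _ , ef′) = eval-∃<ᵖ _ N (k ∷ m ∷ []) .to ef
        (j , _ , eg′) = eval-∃<ᵖ _ N (k ∷ n ∷ []) .to eg
    in k , R⇔f m k .from (i , ef′) , S⇔g k n .from (j , eg′)

  complete : ∀ m n → ∃[ k ] (R m k × S k n) → ∃[ N ] eval h (m ∷ n ∷ N ∷ []) ≡ 0
  complete m n (k , r , s) =
    let (i , ef) = R⇔f m k .to r
        (j , eg) = S⇔g k n .to s
        -- The successor is there because the bounds are strict.
        N = suc (k ⊔ (i ⊔ j))
        k<N = s≤s (m≤m⊔n k (i ⊔ j))
        i<N = s≤s (≤-transᴺ (m≤m⊔n i j) (m≤n⊔m k (i ⊔ j)))
        j<N = s≤s (≤-transᴺ (m≤n⊔m i j) (m≤n⊔m k (i ⊔ j)))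
    in N , eval-∃<ᵖ both N (N ∷ m ∷ n ∷ []) .from
      (k , k<N , eval-andᵖ (eval f< (N ∷ k ∷ m ∷ [])) (eval g< (N ∷ k ∷ n ∷ [])) .from
        ( eval-∃<ᵖ _ N (k ∷ m ∷ []) .from (i , i<N , ef)
        , eval-∃<ᵖ _ N (k ∷ n ∷ []) .from (j , j<N , eg)))

-- Interpolation for the way-below relation

module _ (D : DCPO) where
  open DCPO D using (poset; ≤-refl; ≤-trans) renaming (_≤_ to _≤ᴰ_)

  private
    infix 4 _≪ᴰ_
    _≪ᴰ_ = _≪_ D

  ≪⇒≤ : ∀ {x y} → x ≪ᴰ y → x ≤ᴰ y
  ≪⇒≤ {y = y} x≪y = proj₂ (x≪y ℕ (λ _ → y) (0 , λ _ _ → 0 , ≤-refl , ≤-refl) y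
    (record { upper = λ _ → ≤-refl ; least = λ _ u → u 0 }) ≤-refl)

  ≪-≤-trans : ∀ {x y z} → x ≪ᴰ y → y ≤ᴰ z → x ≪ᴰ z
  ≪-≤-trans x≪y y≤z I s d w l z≤w = x≪y I s d w l (≤-trans y≤z z≤w)

  ≤-≪-trans : ∀ {x y z} → x ≤ᴰ y → y ≪ᴰ z → x ≪ᴰ z
  ≤-≪-trans x≤y y≪z I s d w l z≤w = let (i , y≤sᵢ) = y≪z I s d w l z≤w in i , ≤-trans x≤y y≤sᵢ

  module _ (E : EffectiveStructure D) where
    open EffectiveStructure E

    -- The basis elements approximating the approximants of `z` form a directed family with supremum
    -- `z`, so `x` lies below one of them.
    ≪-interpolate : ∀ {x z} → x ≪ᴰ z → ∃[ n ] (x ≪ᴰ β n × β n ≪ᴰ z)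
    ≪-interpolate {x} {z} x≪z =
      let ((i , j) , x≤tᵢⱼ) = x≪z J t t-directed z t-lub ≤-refl
      in α i , ≤-≪-trans x≤tᵢⱼ (below i j) , ≪z i
      where
      I = proj₁ (basis z)
      α = proj₁ (proj₂ (basis z))
      α-directed = proj₁ (proj₂ (proj₂ (basis z)))
      ≪z = proj₁ (proj₂ (proj₂ (proj₂ (basis z))))
      α-lub = proj₂ (proj₂ (proj₂ (proj₂ (basis z))))

      module _ (i : I) where
        private b = basis (β (α i))
        Iᵢ = proj₁ b
        αᵢ = proj₁ (proj₂ b)
        αᵢ-directed = proj₁ (proj₂ (proj₂ b))
        below = proj₁ (proj₂ (proj₂ (proj₂ b)))
        αᵢ-lub = proj₂ (proj₂ (proj₂ (proj₂ b)))

      J : Set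
      J = Σ I Iᵢ

      t : J → ∣ D ∣
      t (i , j) = β (αᵢ i j)

      t-directed : Directed poset t
      t-directed = (proj₁ α-directed , proj₁ (αᵢ-directed _)) , λ (i , j) (i′ , j′) →
        let (i″ , p , p′) = proj₂ α-directed i i′
            y = β (α i″)
            -- Both elements are way below `y`, hence below members of the family chosen for `y`,
            -- which is directed.
            (l , q)  = ≪-≤-trans (below i j) p _ _ (αᵢ-directed i″) y (αᵢ-lub i″) ≤-refl
            (l′ , q′) = ≪-≤-trans (below i′ j′) p′ _ _ (αᵢ-directed i″) y (αᵢ-lub i″) ≤-refl
            (l″ , r , r′) = proj₂ (αᵢ-directed i″) l l′
        in (i″ , l″) , ≤-trans q r , ≤-trans q′ r′

      t-lub : IsLub poset t z
      t-lub = record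
        { upper = λ (i , j) → ≤-trans (≪⇒≤ (below i j)) (≪⇒≤ (≪z i))
        ; least = λ y u → IsLub.least α-lub y λ i → IsLub.least (αᵢ-lub i) y λ j → u (i , j)
        }

    -- Interpolating first turns the bound `≤` supplied by the definition of `≪` into `≪`.
    ≪-lub : ∀ {x z} {I : Set} (s : I → ∣ D ∣) → Directed poset s → IsLub poset s z →
            x ≪ᴰ z → ∃[ i ] x ≪ᴰ s i
    ≪-lub s d l x≪z =
      let (_ , x≪b , b≪z) = ≪-interpolate x≪z
          (i , b≤sᵢ)      = b≪z _ s d _ l ≤-refl
      in i , ≪-≤-trans x≪b b≤sᵢ

-- Composition of computable maps

infixr 9 _∘ᵈ_

_∘ᵈ_ : ∀ {C D E} → D ⟶ E → C ⟶ D → C ⟶ E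
_∘ᵈ_ {C} {D} {E} g f = record
  { app        = app g ∘ app f
  ; monotone   = _⟶_.monotone g ∘ _⟶_.monotone f
  ; continuous = λ s d x l →
      _⟶_.continuous g (app f ∘ s) (mono-directed {C} {D} f s d) (app f x)
        (_⟶_.continuous f s d x l)
  }

∘ᵈ-computable : ∀ {A B C : Domain} (g : Domain.dcpo B ⟶ Domain.dcpo C)
                (f : Domain.dcpo A ⟶ Domain.dcpo B) →
                Computable B C g → Computable A B f →
                Computable A C (_∘ᵈ_ {Domain.dcpo A} {Domain.dcpo B} {Domain.dcpo C} g f)
∘ᵈ-computable {A} {B} {C} g f g-re f-re =
  RE-cong (λ m n → mk⇔ (factor (app f (a m)) (c n)) (compose (app f (a m)) (c n)))
    (RE-∘ f-re g-re)
  where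
  module B = Domain B
  module C = Domain C
  a = EffectiveStructure.β (Domain.eff A)
  b = EffectiveStructure.β B.eff
  c = EffectiveStructure.β C.eff

  factor : ∀ y z → _≪_ C.dcpo z (app g y) → ∃[ k ] (_≪_ B.dcpo (b k) y × _≪_ C.dcpo z (app g (b k)))
  factor y z z≪gy =
    let (I , α , α-directed , ≪y , α-lub) = EffectiveStructure.basis B.eff y
        -- By continuity, `app g y` is the supremum of the images of the basis elements
        -- approximating `y`.
        (i , z≪gb) = ≪-lub C.dcpo C.eff (app g ∘ b ∘ α)
          (mono-directed {B.dcpo} {C.dcpo} g (b ∘ α) α-directed)
          (_⟶_.continuous g (b ∘ α) α-directed y α-lub) z≪gy
    in α i , ≪y i , z≪gb

  compose : ∀ y z → ∃[ k ] (_≪_ B.dcpo (b k) y × _≪_ C.dcpo z (app g (b k))) → _≪_ C.dcpo z (app g y)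
  compose y z (_ , b≪y , z≪gb) =
    ≪-≤-trans C.dcpo z≪gb (_⟶_.monotone g (≪⇒≤ B.dcpo b≪y))

-- Negation on the flat booleans

not⊥ : Bool⊥ → Bool⊥
not⊥ bot = bot
not⊥ 𝟎   = 𝟏
not⊥ 𝟏   = 𝟎

not⊥-involutive : ∀ x → not⊥ (not⊥ x) ≡ x
not⊥-involutive bot = refl
not⊥-involutive 𝟎   = refl
not⊥-involutive 𝟏   = refl

not⊥-mono : ∀ {x y} → x ⊑ y → not⊥ x ⊑ not⊥ y
not⊥-mono bot⊑   = bot⊑
not⊥-mono ⊑-refl = ⊑-refl

not⊥-defined : ∀ {x} → x ≢ bot → not⊥ x ≢ bot
not⊥-defined {bot} x≢⊥ _ = x≢⊥ refl

module _ (em : ExcludedMiddle 1ℓ) where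

  neg : 𝔹ᵈ em ⟶ 𝔹ᵈ em
  neg = record
    { app        = not⊥
    ; monotone   = not⊥-mono
    ; continuous = λ s _ x l → record
      { upper = λ i → not⊥-mono (IsLub.upper l i)
      -- As a monotone involution, negation turns an upper bound `y` of the negated family into the
      -- upper bound `not⊥ y` of `s`.
      ; least = λ y u → subst (not⊥ x ⊑_) (not⊥-involutive y)
          (not⊥-mono (IsLub.least l (not⊥ y) λ i →
            subst (_⊑ not⊥ y) (not⊥-involutive (s i)) (not⊥-mono (u i))))
      }
    }

  -- Negation maps basis elements to basis elements, so its graph relation is `≪` on the basis,
  -- reindexed by `swapᵖ`.
  neg-computable : Computable (𝔹-domain em) (𝔹-domain em) neg
  neg-computable = RE-cong
    (λ m n → subst (λ y → _≪_ (𝔹ᵈ em) (βᵇ n) y ⇔ _≪_ (𝔹ᵈ em) (βᵇ n) (βᵇ (eval swapᵖ (m ∷ []))))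
      (β-swap m) (mk⇔ (λ p → p) (λ p → p)))
    (RE-flip swapᵖ (EffectiveStructure.≪-re (𝔹-effective em)))
    where
    -- 0 ↦ 0, 1 ↦ 2 and n + 2 ↦ 1, following the enumeration βᵇ.
    swapᵖ : PrimRec 1
    swapᵖ = recᵖ zeroᵖ (compᵖ (recᵖ (compᵖ sucᵖ (compᵖ sucᵖ (zeroᵖ ∷ []) ∷ []))
                                    (compᵖ sucᵖ (zeroᵖ ∷ [])))
                              (projᵖ 0F ∷ []))

    β-swap : ∀ m → βᵇ (eval swapᵖ (m ∷ [])) ≡ not⊥ (βᵇ m)
    β-swap 0             = refl
    β-swap 1             = refl
    β-swap (suc (suc m)) = refl

-- From a search operator to a quantifier

lemma3p4 : ∀ {ℓ k} (em : ExcludedMiddle 1ℓ) (𝒞 : CCC em ℓ) (D : CCC.Object 𝒞)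
    (K : Pred ∣ CCC.⟦_⟧ 𝒞 D ∣ k) →
    Searchable em 𝒞 D K → Exhaustible em 𝒞 D K
lemma3p4 em 𝒞 D K (ε , ε-computable , ε-searches) =
  ∀ᴷ , ∀ᴷ-computable , λ p p-def →
    let (x₀∈K , finds) = ε-searches (app ¬∘ p) (λ x x∈K → not⊥-defined (p-def x x∈K))
        x₀ = app ε (app ¬∘ p)
    -- Here `app ∀ᴷ p` unfolds to `app p x₀`.
    in (λ p≡𝟏 → p≡𝟏 x₀ x₀∈K) ,
       -- The search for `¬ ∘ p` succeeds at `x₀`; negating once more gives the value `𝟎` of `p`
       -- there.
       (λ (x , x∈K , px≡𝟎) → trans (sym (not⊥-involutive (app p x₀)))
         (cong not⊥ (finds (x , x∈K , cong not⊥ px≡𝟎))))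
  where
  open CCC 𝒞

  P : Object
  P = D ⇒ 𝔹

  evaluate : ⟦ P ⊗ D ⟧ ⟶ ⟦ 𝔹 ⟧
  evaluate = apply ⟦ D ⟧ ⟦ 𝔹 ⟧

  counter : ⟦ P ⊗ D ⟧ ⟶ ⟦ 𝔹 ⟧
  counter = _∘ᵈ_ {⟦ P ⊗ D ⟧} {⟦ 𝔹 ⟧} {⟦ 𝔹 ⟧} (neg em) evaluate

  -- The identity up to η, here with its computability proof for free.
  same ¬∘ : ⟦ P ⟧ ⟶ ⟦ P ⟧
  same = curry ⟦ D ⟧ ⟦ 𝔹 ⟧ {⟦ P ⟧} evaluate
  ¬∘   = curry ⟦ D ⟧ ⟦ 𝔹 ⟧ {⟦ P ⟧} counter

  candidate : ⟦ P ⟧ ⟶ ⟦ D ⟧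
  candidate = _∘ᵈ_ {⟦ P ⟧} {⟦ P ⟧} {⟦ D ⟧} ε ¬∘

  paired : ⟦ P ⟧ ⟶ ⟦ P ⊗ D ⟧
  paired = pair ⟦ P ⟧ ⟦ D ⟧ {⟦ P ⟧} same candidate

  ∀ᴷ : ⟦ P ⟧ ⟶ ⟦ 𝔹 ⟧
  ∀ᴷ = _∘ᵈ_ {⟦ P ⟧} {⟦ P ⊗ D ⟧} {⟦ 𝔹 ⟧} evaluate paired

  same-computable : IsComputable P P same
  same-computable = curry-computable D 𝔹 P evaluate (apply-computable D 𝔹)

  ¬∘-computable : IsComputable P P ¬∘
  ¬∘-computable = curry-computable D 𝔹 P counter
    (∘ᵈ-computable {proj₁ (P ⊗ D)} {proj₁ 𝔹} {proj₁ 𝔹} (neg em) evaluate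
      (neg-computable em) (apply-computable D 𝔹))

  candidate-computable : IsComputable P D candidate
  candidate-computable =
    ∘ᵈ-computable {proj₁ P} {proj₁ P} {proj₁ D} ε ¬∘ ε-computable ¬∘-computable

  ∀ᴷ-computable : IsComputable P 𝔹 ∀ᴷ
  ∀ᴷ-computable = ∘ᵈ-computable {proj₁ P} {proj₁ (P ⊗ D)} {proj₁ 𝔹} evaluate paired
    (apply-computable D 𝔹)
    (pair-computable P D P same candidate same-computable candidate-computable)
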